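{- Let $a_1, \dots, a_n \in \mathbb{Z}^d$ be pairwise distinct primitive integer vectors, let $D \subseteq (0,\infty)$ be a dense subset, and for each $w \in \mathbb{Z}^d$ let $f_w : \mathbb{R} \to \mathbb{R}$ be a function. Then there is at most one tuple of real numbers $(b_1, \dots, b_n)$ such that: $P = \bigcap_{i=1}^n \{x \in \mathbb{R}^d : \langle a_i, x\rangle \le b_i\}$ is a full-dimensional polytope; $f_w(s) = L_{P+w}(s)$ for all $w \in \mathbb{Z}^d$ and all $s \in D$; and for each $i$ the set $F_i = P \cap \{x : \langle a_i, x\rangle = b_i\}$ is a nonempty face of $P$.
   Context: For a polytope $P \subseteq \mathbb{R}^d$ and real $s \ge 0$, $L_P(s) = \#(sP \cap \mathbb{Z}^d)$, where $sP = \{sx : x \in P\}$. A vector $a \in \mathbb{Z}^d$ is primitive if the greatest common divisor of its coordinates is $1$. -}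

module Defs where

open import Algebra.Bundles using (CommutativeRing)
import Algebra.Properties.Semiring.Mult as Mult
import Algebra.Properties.Semiring.Sum as Sum
open import Data.Fin.Base using (Fin)
open import Data.Integer.Base as ℤ using (ℤ; +_; -[1+_]; 0ℤ; 1ℤ)
import Data.Integer.GCD as ℤ
open import Data.List.Base using (List; length)
import Data.List.Membership.Propositional as List
open import Data.List.Relation.Unary.Unique.Propositional using (Unique)
open import Data.Nat.Base using (ℕ; suc)
open import Data.Product.Base using (∃; ∃-syntax; _×_)
open import Data.Vec.Base as Vec using (Vec)
open import Data.Vec.Functional using (Vector; map; zipWith)
import Data.Vec.Functional.Relation.Binary.Equality.Setoid as VectorEquality
open import Function.Bundles using (Func; _⇔_; _⟨$⟩_)
open import Level using (0ℓ) renaming (suc to lsuc)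
open import Relation.Binary.Core using (Rel)
open import Relation.Binary.Definitions using (_Respects_)
open import Relation.Binary.PropositionalEquality.Core using (_≡_)
import Relation.Binary.Construct.StrictToNonStrict as StrictToNonStrict
open import Relation.Binary.Structures using (IsStrictTotalOrder)
open import Relation.Nullary.Negation.Core using (¬_)
open import Relation.Unary using (Pred; Satisfiable; Universal; _∩_; _⊆_; _≐_)

-- The library has no real numbers, so ℝ is given by its axioms: it is the
-- Dedekind-complete ordered field, which is unique up to isomorphism.
record CompleteOrderedField : Set (lsuc 0ℓ) where
  infix 4 _<_
  field
    commutativeRing : CommutativeRing 0ℓ 0ℓ

  open CommutativeRing commutativeRing public

  field
    _<_                : Rel Carrier 0ℓ
    isStrictTotalOrder : IsStrictTotalOrder _≈_ _<_
    0<1                : 0# < 1#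
    inverse            : ∀ x → ¬ (x ≈ 0#) → ∃[ y ] x * y ≈ 1#
    +-monoˡ-<          : ∀ z {x y} → x < y → x + z < y + z
    *-pos              : ∀ {x y} → 0# < x → 0# < y → 0# < x * y

  open StrictToNonStrict _≈_ _<_ public using (_≤_)

  UpperBound : Pred Carrier 0ℓ → Pred Carrier 0ℓ
  UpperBound S u = ∀ {x} → S x → x ≤ u

  field
    supremum : (S : Pred Carrier 0ℓ) → Satisfiable S → Satisfiable (UpperBound S) →
               ∃[ u ] UpperBound S u × (∀ {v} → UpperBound S v → u ≤ v)

Primitive : ∀ {d} → Vec ℤ d → Set
Primitive a = Vec.foldr′ ℤ.gcd 0ℤ a ≡ 1ℤ

module Geometry (𝓡 : CompleteOrderedField) where

  open CompleteOrderedField 𝓡 public renaming (Carrier to ℝ)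
  open Mult semiring using () renaming (_×_ to _×ℕ_)
  open Sum semiring using (sum)
  open VectorEquality setoid public using (_≋_)

  infixl 6 _+ᵥ_
  infixl 7 _·ᵥ_
  infix 4 _isFaceOf_

  ℝ^_ : ℕ → Set
  ℝ^ d = Vector ℝ d

  fromℕ : ℕ → ℝ
  fromℕ n = n ×ℕ 1#

  fromℤ : ℤ → ℝ
  fromℤ (+ n)    = fromℕ n
  fromℤ -[1+ n ] = - fromℕ (suc n)

  embed : ∀ {d} → Vec ℤ d → ℝ^ d
  embed z k = fromℤ (Vec.lookup z k)

  _+ᵥ_ : ∀ {d} → ℝ^ d → ℝ^ d → ℝ^ d
  _+ᵥ_ = zipWith _+_

  _·ᵥ_ : ∀ {d} → ℝ → ℝ^ d → ℝ^ d
  s ·ᵥ x = map (s *_) x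

  ⟨_,_⟩ : ∀ {d} → ℝ^ d → ℝ^ d → ℝ
  ⟨ x , y ⟩ = sum (zipWith _*_ x y)

  combination : ∀ {d m} → Vector ℝ m → Vector (ℝ^ d) m → ℝ^ d
  combination c v k = sum (λ j → c j * v j k)

  AffineHull : ∀ {d} → Pred (ℝ^ d) 0ℓ → Pred (ℝ^ d) 0ℓ
  AffineHull {d} P y =
    ∃[ m ] ∃ λ (v : Vector (ℝ^ d) m) → ∃ λ (c : Vector ℝ m) →
      (∀ j → P (v j)) × sum c ≈ 1# × y ≋ combination c v

  ConvexHull : ∀ {d m} → Vector (ℝ^ d) m → Pred (ℝ^ d) 0ℓ
  ConvexHull {m = m} v y =
    ∃ λ (c : Vector ℝ m) →
      (∀ j → 0# ≤ c j) × sum c ≈ 1# × y ≋ combination c v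

  IsPolytope : ∀ {d} → Pred (ℝ^ d) 0ℓ → Set
  IsPolytope {d} P = ∃[ m ] ∃ λ (v : Vector (ℝ^ d) m) → P ≐ ConvexHull v

  -- The dimension of P is that of its affine hull, so it equals d exactly
  -- when the affine hull is all of ℝ^d.
  FullDimensional : ∀ {d} → Pred (ℝ^ d) 0ℓ → Set
  FullDimensional P = Universal (AffineHull P)

  HalfSpace Hyperplane : ∀ {d} → ℝ^ d → ℝ → Pred (ℝ^ d) 0ℓ
  HalfSpace  c δ x = ⟨ c , x ⟩ ≤ δ
  Hyperplane c δ x = ⟨ c , x ⟩ ≈ δ

  _isFaceOf_ : ∀ {d} → Pred (ℝ^ d) 0ℓ → Pred (ℝ^ d) 0ℓ → Set
  _isFaceOf_ {d} F P =
    ∃ λ (c : ℝ^ d) → ∃[ δ ] P ⊆ HalfSpace c δ × F ≐ P ∩ Hyperplane c δ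

  polyhedron : ∀ {n d} → (Fin n → Vec ℤ d) → (Fin n → ℝ) → Pred (ℝ^ d) 0ℓ
  polyhedron a b x = ∀ i → HalfSpace (embed (a i)) (b i) x

  translate : ∀ {d} → Vec ℤ d → Pred (ℝ^ d) 0ℓ → Pred (ℝ^ d) 0ℓ
  translate w P y = ∃[ x ] P x × y ≋ x +ᵥ embed w

  dilate : ∀ {d} → ℝ → Pred (ℝ^ d) 0ℓ → Pred (ℝ^ d) 0ℓ
  dilate s P y = ∃[ x ] P x × y ≋ s ·ᵥ x

  -- y = L_P(s).  A subset of ℤ^d has no cardinality as a function of the
  -- subset, so the count is witnessed by a repetition-free list of exactly
  -- the integer points of sP.
  IsLatticeCount : ∀ {d} → Pred (ℝ^ d) 0ℓ → ℝ → Pred ℝ 0ℓ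
  IsLatticeCount {d} P s y =
    ∃ λ (zs : List (Vec ℤ d)) →
      Unique zs ×
      (∀ z → z List.∈ zs ⇔ dilate s P (embed z)) ×
      y ≈ fromℕ (length zs)

  record IsDenseInPositives (D : Pred ℝ 0ℓ) : Set where
    field
      respects : D Respects _≈_
      positive : D ⊆ (0# <_)
      dense    : ∀ {x ε} → 0# < x → 0# < ε → ∃[ s ] D s × x - ε < s × s < x + ε

  record IsSolution {n d} (a : Fin n → Vec ℤ d) (D : Pred ℝ 0ℓ)
                    (f : Vec ℤ d → Func setoid setoid) (b : Fin n → ℝ) : Set where
    P : Pred (ℝ^ d) 0ℓ
    P = polyhedron a b

    F : Fin n → Pred (ℝ^ d) 0ℓ
    F i = P ∩ Hyperplane (embed (a i)) (b i)

    field
      isPolytope      : IsPolytope P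
      fullDimensional : FullDimensional P
      counts          : ∀ w {s} → D s → IsLatticeCount (translate w P) s (f w ⟨$⟩ s)
      faces           : ∀ i → F i isFaceOf P
      facesNonempty   : ∀ i → Satisfiable (F i)

{-# OPTIONS --safe #-}

-- It suffices to refute bᵢ < b′ᵢ for the polytopes P and Q of the two tuples.
-- Since the i-th face of Q is nonempty and Q is full-dimensional, some box
-- around an interior point y of Q is separated from P by the i-th hyperplane.
-- For r in a suitable interval arbitrarily far out there are z, w ∈ ℤ^d with
-- r z − w in that box: choose one coordinate of z and w after the other,
-- shrinking the interval each time.  Take such an r with s = 1/r ∈ D.  Then z is
-- a lattice point of s(Q + w), so by equality of the counts s(P + w) contains
-- a lattice point z′.  Points of P and of Q differ by less than r in every
-- coordinate, so r z − w ∈ Q and r z′ − w ∈ P force z′ = z; but r z − w ∉ P.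
--
-- Equality of reals is decidable, so the goal is ¬¬-stable, and existence
-- claims that have no constructive proof (starting with the Archimedean
-- property) are proved and used doubly negated.
module Submission where

open import Defs
import Algebra.Properties.AbelianGroup as AbelianGroupProperties
import Algebra.Properties.Ring as RingProperties
import Algebra.Properties.Semiring.Mult as Mult
import Algebra.Properties.Semiring.Sum as Sum
import Algebra.Solver.Ring as RingSolver
open import Algebra.Solver.Ring.AlmostCommutativeRing using (fromCommutativeRing; _-Raw-AlmostCommutative⟶_)
open import Data.Fin.Base using (Fin; zero; suc)
open import Data.Integer.Base as ℤ using (ℤ; +_; -[1+_]; 0ℤ; 1ℤ)
import Data.Integer.GCD as ℤ
import Data.Integer.Properties as ℤ
open import Data.List.Base using (List; []; _∷_; length; allFin)
open import Data.List.Membership.Propositional using (_∈_)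
open import Data.List.Membership.Propositional.Properties using (∈-allFin)
open import Data.List.Relation.Unary.All as All using (All; []; _∷_)
open import Data.List.Relation.Unary.Any using (here)
import Data.Maybe.Base as Maybe
open import Data.Nat.Base as ℕ using (ℕ; zero; suc)
import Data.Nat.GCD as ℕ
open import Data.Product.Base using (∃; ∃-syntax; _×_; _,_; proj₁; proj₂)
open import Data.Sum.Base using (inj₁; inj₂)
open import Data.Vec.Base as Vec using (Vec; []; _∷_)
import Data.Vec.Functional as Vector
open import Data.Vec.Relation.Binary.Pointwise.Extensional using (ext; Pointwise-≡⇒≡)
open import Function.Base using (_∘_)
open import Function.Bundles using (Equivalence; Func)
open import Level using (0ℓ)
open import Relation.Binary.Bundles using (StrictTotalOrder)
import Relation.Binary.Construct.StrictToNonStrict as StrictToNonStrict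
open import Relation.Binary.Definitions using (Tri; tri<; tri≈; tri>)
import Relation.Binary.Properties.StrictTotalOrder as StrictTotalOrderProperties
open import Relation.Binary.PropositionalEquality.Core as ≡ using (_≡_; _≢_)
import Relation.Binary.Reasoning.StrictPartialOrder as StrictReasoning
open import Relation.Nullary.Decidable.Core using (dec⇒maybe; yes; no)
open import Relation.Nullary.Negation.Core using (¬_; contradiction)
open import Relation.Unary using (Pred; _⊆_)

-- Primitive integer vectors.

primitive⇒nonzero : ∀ {d} (a : Vec ℤ d) → Primitive a → ∃[ k ] Vec.lookup a k ≢ 0ℤ
primitive⇒nonzero [] ()
primitive⇒nonzero (x ∷ a) gcd≡1 with x ℤ.≟ 0ℤ
... | no x≢0 = zero , x≢0
-- A zero entry does not change the gcd, so the tail is again primitive; the recursion cannot run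
-- out of entries, because the empty gcd is 0 and not 1.
... | yes ≡.refl with primitive⇒nonzero a (≡.trans (≡.sym (gcd[0,i]≡i a)) gcd≡1)
  where
  gcd[0,i]≡i : ∀ {d} (a : Vec ℤ d) → ℤ.gcd 0ℤ (Vec.foldr′ ℤ.gcd 0ℤ a) ≡ Vec.foldr′ ℤ.gcd 0ℤ a
  gcd[0,i]≡i []      = ≡.refl
  gcd[0,i]≡i (y ∷ a) = ≡.cong +_ (ℕ.gcd-identityˡ _)
... | k , aₖ≢0 = suc k , aₖ≢0

lookup-injective : ∀ {d} {u v : Vec ℤ d} → (∀ k → Vec.lookup u k ≡ Vec.lookup v k) → u ≡ v
lookup-injective u≗v = Pointwise-≡⇒≡ (ext u≗v)

module OrderedField (𝓡 : CompleteOrderedField) where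

  open Geometry 𝓡 hiding (zero)
  open RingProperties ring using (-‿distribˡ-*; -‿distribʳ-*)
  open AbelianGroupProperties +-abelianGroup public
    using () renaming (⁻¹-involutive to -‿involutive; ⁻¹-∙-comm to -‿+-comm; ε⁻¹≈ε to -0≈0)
  open Mult semiring using (×-homo-+; ×1-homo-*)

  strictTotalOrder : StrictTotalOrder _ _ _
  strictTotalOrder = record { isStrictTotalOrder = isStrictTotalOrder }

  open StrictTotalOrder strictTotalOrder public
    using (compare; irrefl; asym; strictPartialOrder; <-respʳ-≈; <-respˡ-≈)
    renaming (trans to <-trans)
  open StrictTotalOrderProperties strictTotalOrder public
    using (total) renaming (refl to ≤-refl; reflexive to ≤-reflexive; trans to ≤-trans)
  open StrictToNonStrict _≈_ _<_ public using (<⇒≤)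
  open StrictReasoning strictPartialOrder public

  -- The ring homomorphism from the integers to the reals.

  fromℤ-⊖ : ∀ m n → fromℤ (m ℤ.⊖ n) ≈ fromℕ m - fromℕ n
  fromℤ-⊖ zero zero = sym (-‿inverseʳ 0#)
  fromℤ-⊖ zero (suc n) = sym (+-identityˡ _)
  fromℤ-⊖ (suc m) zero = sym (trans (+-congˡ -0≈0) (+-identityʳ _))
  fromℤ-⊖ (suc m) (suc n) = begin-equality
    fromℤ (suc m ℤ.⊖ suc n)                    ≡⟨ ≡.cong fromℤ (ℤ.[1+m]⊖[1+n]≡m⊖n m n) ⟩
    fromℤ (m ℤ.⊖ n)                            ≈⟨ fromℤ-⊖ m n ⟩
    fromℕ m - fromℕ n                          ≈⟨ +-congˡ (+-identityˡ _) ⟨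
    fromℕ m + (0# - fromℕ n)                   ≈⟨ +-congˡ (+-congʳ (-‿inverseʳ 1#)) ⟨
    fromℕ m + ((1# - 1#) - fromℕ n)            ≈⟨ +-congˡ (+-assoc _ _ _) ⟩
    fromℕ m + (1# + (- 1# - fromℕ n))          ≈⟨ +-assoc _ _ _ ⟨
    (fromℕ m + 1#) + (- 1# - fromℕ n)          ≈⟨ +-cong (+-comm _ _) (-‿+-comm _ _) ⟩
    fromℕ (suc m) - fromℕ (suc n)              ∎

  fromℤ-+ : ∀ i j → fromℤ (i ℤ.+ j) ≈ fromℤ i + fromℤ j
  fromℤ-+ (+ m) (+ n) = ×-homo-+ 1# m n
  fromℤ-+ (+ m) -[1+ n ] = fromℤ-⊖ m (suc n)
  fromℤ-+ -[1+ m ] (+ n) = trans (fromℤ-⊖ n (suc m)) (+-comm _ _)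
  fromℤ-+ -[1+ m ] -[1+ n ] = begin-equality
    - (1# + fromℕ (suc (m ℕ.+ n)))         ≈⟨ -‿cong (+-congˡ (×-homo-+ 1# (suc m) n)) ⟩
    - (1# + (fromℕ (suc m) + fromℕ n))     ≈⟨ -‿cong (+-assoc _ _ _) ⟨
    - ((1# + fromℕ (suc m)) + fromℕ n)     ≈⟨ -‿cong (+-congʳ (+-comm _ _)) ⟩
    - ((fromℕ (suc m) + 1#) + fromℕ n)     ≈⟨ -‿cong (+-assoc _ _ _) ⟩
    - (fromℕ (suc m) + fromℕ (suc n))      ≈⟨ -‿+-comm _ _ ⟨
    - fromℕ (suc m) - fromℕ (suc n)        ∎

  fromℤ-neg : ∀ i → fromℤ (ℤ.- i) ≈ - fromℤ i
  fromℤ-neg (+ zero)  = sym -0≈0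
  fromℤ-neg (+ suc n) = refl
  fromℤ-neg -[1+ n ]  = sym (-‿involutive _)

  fromℤ-pos-* : ∀ m j → fromℤ (+ m ℤ.* j) ≈ fromℕ m * fromℤ j
  fromℤ-pos-* m (+ n) = begin-equality
    fromℤ (+ m ℤ.* + n)  ≡⟨ ≡.cong fromℤ (ℤ.pos-* m n) ⟨
    fromℕ (m ℕ.* n)      ≈⟨ ×1-homo-* m n ⟩
    fromℕ m * fromℕ n    ∎
  fromℤ-pos-* m -[1+ n ] = begin-equality
    fromℤ (+ m ℤ.* -[1+ n ])       ≡⟨ ≡.cong fromℤ (ℤ.neg-distribʳ-* (+ m) (+ suc n)) ⟨
    fromℤ (ℤ.- (+ m ℤ.* + suc n))  ≈⟨ fromℤ-neg (+ m ℤ.* + suc n) ⟩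
    - fromℤ (+ m ℤ.* + suc n)      ≈⟨ -‿cong (fromℤ-pos-* m (+ suc n)) ⟩
    - (fromℕ m * fromℕ (suc n))    ≈⟨ -‿distribʳ-* _ _ ⟩
    fromℕ m * - fromℕ (suc n)      ∎

  fromℤ-* : ∀ i j → fromℤ (i ℤ.* j) ≈ fromℤ i * fromℤ j
  fromℤ-* (+ m) j = fromℤ-pos-* m j
  fromℤ-* -[1+ m ] j = begin-equality
    fromℤ (-[1+ m ] ℤ.* j)       ≡⟨ ≡.cong fromℤ (ℤ.neg-distribˡ-* (+ suc m) j) ⟨
    fromℤ (ℤ.- (+ suc m ℤ.* j))  ≈⟨ fromℤ-neg (+ suc m ℤ.* j) ⟩
    - fromℤ (+ suc m ℤ.* j)      ≈⟨ -‿cong (fromℤ-pos-* (suc m) j) ⟩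
    - (fromℕ (suc m) * fromℤ j)  ≈⟨ -‿distribˡ-* _ _ ⟩
    - fromℕ (suc m) * fromℤ j    ∎

  -- Equality in ℝ does not compute, so the ring solver can cancel terms only
  -- with coefficients taken from ℤ.
  fromℤ-morphism : ℤ.+-*-rawRing -Raw-AlmostCommutative⟶ fromCommutativeRing commutativeRing
  fromℤ-morphism = record
    { ⟦_⟧    = fromℤ
    ; +-homo = fromℤ-+
    ; *-homo = fromℤ-*
    ; -‿homo = fromℤ-neg
    ; 0-homo = refl
    ; 1-homo = +-identityʳ 1#
    }

  open RingSolver ℤ.+-*-rawRing (fromCommutativeRing commutativeRing) fromℤ-morphism
    (λ i j → Maybe.map (reflexive ∘ ≡.cong fromℤ) (dec⇒maybe (i ℤ.≟ j)))
    public using (solve; _:=_; _:+_; _:*_; _:-_; :-_)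

  -- Arithmetic of inequalities.

  +-monoʳ-< : ∀ z {x y} → x < y → z + x < z + y
  +-monoʳ-< z x<y = <-respˡ-≈ (+-comm _ _) (<-respʳ-≈ (+-comm _ _) (+-monoˡ-< z x<y))

  +-monoˡ-≤ : ∀ z {x y} → x ≤ y → x + z ≤ y + z
  +-monoˡ-≤ z (inj₁ x<y) = inj₁ (+-monoˡ-< z x<y)
  +-monoˡ-≤ z (inj₂ x≈y) = inj₂ (+-congʳ x≈y)

  +-monoʳ-≤ : ∀ z {x y} → x ≤ y → z + x ≤ z + y
  +-monoʳ-≤ z (inj₁ x<y) = inj₁ (+-monoʳ-< z x<y)
  +-monoʳ-≤ z (inj₂ x≈y) = inj₂ (+-congˡ x≈y)

  +-mono-≤ : ∀ {x y u v} → x ≤ y → u ≤ v → x + u ≤ y + v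
  +-mono-≤ x≤y u≤v = ≤-trans (+-monoˡ-≤ _ x≤y) (+-monoʳ-≤ _ u≤v)

  +-mono-<-≤ : ∀ {x y u v} → x < y → u ≤ v → x + u < y + v
  +-mono-<-≤ {x} {y} {u} {v} x<y u≤v = begin-strict
    x + u <⟨ +-monoˡ-< u x<y ⟩
    y + u ≤⟨ +-monoʳ-≤ y u≤v ⟩
    y + v ∎

  +-mono-≤-< : ∀ {x y u v} → x ≤ y → u < v → x + u < y + v
  +-mono-≤-< {x} {y} {u} {v} x≤y u<v = begin-strict
    x + u ≤⟨ +-monoˡ-≤ u x≤y ⟩
    y + u <⟨ +-monoʳ-< y u<v ⟩
    y + v ∎

  ≮⇒≥ : ∀ {x y} → ¬ (x < y) → y ≤ x
  ≮⇒≥ {x} {y} x≮y with compare x y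
  ... | tri< x<y _ _ = contradiction x<y x≮y
  ... | tri≈ _ x≈y _ = inj₂ (sym x≈y)
  ... | tri> _ _ y<x = inj₁ y<x

  <⇒≱ : ∀ {x y} → x < y → ¬ (y ≤ x)
  <⇒≱ x<y (inj₁ y<x) = asym x<y y<x
  <⇒≱ x<y (inj₂ y≈x) = irrefl (sym y≈x) x<y

  x<y⇒0<y-x : ∀ {x y} → x < y → 0# < y - x
  x<y⇒0<y-x {x} x<y = <-respˡ-≈ (-‿inverseʳ x) (+-monoˡ-< (- x) x<y)

  0<y-x⇒x<y : ∀ {x y} → 0# < y - x → x < y
  0<y-x⇒x<y {x} {y} 0<y-x = begin-strict
    x            ≈⟨ +-identityˡ x ⟨
    0# + x       <⟨ +-monoˡ-< x 0<y-x ⟩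
    (y - x) + x  ≈⟨ solve 2 (λ x y → (y :- x) :+ x := y) refl x y ⟩
    y            ∎

  neg-mono-< : ∀ {x y} → x < y → - y < - x
  neg-mono-< {x} {y} x<y = 0<y-x⇒x<y (<-respʳ-≈ (solve 2 (λ x y → y :- x := :- x :- :- y) refl x y) (x<y⇒0<y-x x<y))

  neg-mono-≤ : ∀ {x y} → x ≤ y → - y ≤ - x
  neg-mono-≤ (inj₁ x<y) = inj₁ (neg-mono-< x<y)
  neg-mono-≤ (inj₂ x≈y) = inj₂ (-‿cong (sym x≈y))

  *-monoˡ-< : ∀ {z x y} → 0# < z → x < y → z * x < z * y
  *-monoˡ-< {z} {x} {y} 0<z x<y = 0<y-x⇒x<y (<-respʳ-≈
    (solve 3 (λ x y z → z :* (y :- x) := z :* y :- z :* x) refl x y z)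
    (*-pos 0<z (x<y⇒0<y-x x<y)))

  *-monoˡ-≤ : ∀ {z x y} → 0# ≤ z → x ≤ y → z * x ≤ z * y
  *-monoˡ-≤ (inj₁ 0<z) (inj₁ x<y) = inj₁ (*-monoˡ-< 0<z x<y)
  *-monoˡ-≤ {z} {x} {y} (inj₂ 0≈z) _ = inj₂ (begin-equality
    z * x    ≈⟨ *-congʳ 0≈z ⟨
    0# * x   ≈⟨ trans (zeroˡ x) (sym (zeroˡ y)) ⟩
    0# * y   ≈⟨ *-congʳ 0≈z ⟩
    z * y    ∎)
  *-monoˡ-≤ _ (inj₂ x≈y) = inj₂ (*-congˡ x≈y)

  *-cancelˡ-< : ∀ {z x y} → 0# < z → z * x < z * y → x < y
  *-cancelˡ-< {z} {x} {y} 0<z zx<zy with compare x y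
  ... | tri< x<y _ _ = x<y
  ... | tri≈ _ x≈y _ = contradiction zx<zy (irrefl (*-congˡ x≈y))
  ... | tri> _ _ y<x = contradiction zx<zy (asym (*-monoˡ-< 0<z y<x))

  0≤* : ∀ {x y} → 0# ≤ x → 0# ≤ y → 0# ≤ x * y
  0≤* {x} 0≤x 0≤y = ≤-trans (≤-reflexive (sym (zeroʳ x))) (*-monoˡ-≤ 0≤x 0≤y)

  0<+ : ∀ {x y} → 0# < x → 0# ≤ y → 0# < x + y
  0<+ 0<x 0≤y = <-respˡ-≈ (+-identityˡ 0#) (+-mono-<-≤ 0<x 0≤y)

  division : ∀ {z} → 0# < z → ∀ x → ∃[ q ] z * q ≈ x
  division {z} 0<z x with inverse z (λ z≈0 → irrefl (sym z≈0) 0<z)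
  ... | z⁻¹ , zz⁻¹≈1 = z⁻¹ * x , (begin-equality
    z * (z⁻¹ * x)  ≈⟨ *-assoc _ _ _ ⟨
    (z * z⁻¹) * x  ≈⟨ *-congʳ zz⁻¹≈1 ⟩
    1# * x         ≈⟨ *-identityˡ x ⟩
    x              ∎)

  quotient-pos : ∀ {z q x} → 0# < z → z * q ≈ x → 0# < x → 0# < q
  quotient-pos {z} {q} {x} 0<z zq≈x 0<x = *-cancelˡ-< 0<z (begin-strict
    z * 0#  ≈⟨ zeroʳ z ⟩
    0#      <⟨ 0<x ⟩
    x       ≈⟨ zq≈x ⟨
    z * q   ∎)

  0≤square : ∀ x → 0# ≤ x * x
  0≤square x with total 0# x
  ... | inj₁ 0≤x = 0≤* 0≤x 0≤x
  ... | inj₂ x≤0 = ≤-trans (0≤* 0≤-x 0≤-x) (≤-reflexive (solve 1 (λ x → :- x :* :- x := x :* x) refl x))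
    where
    0≤-x : 0# ≤ - x
    0≤-x = ≤-trans (≤-reflexive (sym -0≈0)) (neg-mono-≤ x≤0)

  0<square : ∀ {x} → ¬ (x ≈ 0#) → 0# < x * x
  0<square {x} x≉0 with compare 0# x
  ... | tri< 0<x _ _ = *-pos 0<x 0<x
  ... | tri≈ _ 0≈x _ = contradiction (sym 0≈x) x≉0
  ... | tri> _ _ x<0 = <-respʳ-≈ (solve 1 (λ x → :- x :* :- x := x :* x) refl x) (*-pos 0<-x 0<-x)
    where
    0<-x : 0# < - x
    0<-x = <-respˡ-≈ -0≈0 (neg-mono-< x<0)

  -- Multiplying by `x * y` turns `q` into `x` and `p` into `y`. This carries intervals for `s` over
  -- to intervals for `r = 1/s`.
  reciprocal-anti-< : ∀ {x y p q} → 0# < x → x < y → x * p ≈ 1# → y * q ≈ 1# → q < p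
  reciprocal-anti-< {x} {y} {p} {q} 0<x x<y xp≈1 yq≈1 =
    *-cancelˡ-< (*-pos 0<x (<-trans 0<x x<y)) (begin-strict
      (x * y) * q  ≈⟨ *-assoc x y q ⟩
      x * (y * q)  ≈⟨ *-congˡ yq≈1 ⟩
      x * 1#       ≈⟨ *-identityʳ x ⟩
      x            <⟨ x<y ⟩
      y            ≈⟨ *-identityʳ y ⟨
      y * 1#       ≈⟨ *-congˡ xp≈1 ⟨
      y * (x * p)  ≈⟨ solve 3 (λ x y p → y :* (x :* p) := (x :* y) :* p) refl x y p ⟩
      (x * y) * p  ∎)

  -- Finite bounds, small factors and weighted means.

  upperBound₂ : ∀ x y → ∃[ z ] x ≤ z × y ≤ z
  upperBound₂ x y with total x y
  ... | inj₁ x≤y = y , x≤y , ≤-refl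
  ... | inj₂ y≤x = x , ≤-refl , y≤x

  lowerBound₂ : ∀ {w x y} → w < x → w < y → ∃[ z ] w < z × z ≤ x × z ≤ y
  lowerBound₂ {w} {x} {y} w<x w<y with total x y
  ... | inj₁ x≤y = x , w<x , ≤-refl , x≤y
  ... | inj₂ y≤x = y , w<y , y≤x , ≤-refl

  upperBound : ∀ {m} (u : Fin m → ℝ) → ∃[ z ] 0# ≤ z × ∀ j → u j ≤ z
  upperBound {zero} u = 0# , ≤-refl , λ ()
  upperBound {suc m} u with upperBound (u ∘ suc)
  ... | z , 0≤z , u≤z with upperBound₂ (u zero) z
  ...   | z′ , u₀≤z′ , z≤z′ = z′ , ≤-trans 0≤z z≤z′ ,
          λ { zero → u₀≤z′ ; (suc j) → ≤-trans (u≤z j) z≤z′ }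

  positiveLowerBound : ∀ {m} (u : Fin m → ℝ) → (∀ j → 0# < u j) → ∃[ z ] 0# < z × ∀ j → z ≤ u j
  positiveLowerBound {zero} u 0<u = 1# , 0<1 , λ ()
  positiveLowerBound {suc m} u 0<u with positiveLowerBound (u ∘ suc) (0<u ∘ suc)
  ... | z , 0<z , z≤u with lowerBound₂ (0<u zero) 0<z
  ...   | z′ , 0<z′ , z′≤u₀ , z′≤z = z′ , 0<z′ ,
          λ { zero → z′≤u₀ ; (suc j) → ≤-trans z′≤z (z≤u j) }

  double : ∀ x → (1# + 1#) * x ≈ x + x
  double x = trans (distribʳ x 1# 1#) (+-cong (*-identityˡ x) (*-identityˡ x))

  scaleBelow : ∀ {z c} → 0# ≤ z → 0# < c → ∃[ ε ] 0# < ε × z * ε < c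
  scaleBelow {z} {c} 0≤z 0<c = ε , 0<ε , (begin-strict
    z * ε           ≈⟨ +-identityʳ _ ⟨
    z * ε + 0#      <⟨ +-monoʳ-< _ 0<ε ⟩
    z * ε + ε       ≈⟨ +-congˡ (*-identityˡ ε) ⟨
    z * ε + 1# * ε  ≈⟨ distribʳ ε z 1# ⟨
    (z + 1#) * ε    ≈⟨ [z+1]ε≈c ⟩
    c               ∎)
    where
    0<z+1 : 0# < z + 1#
    0<z+1 = <-respʳ-≈ (+-comm 1# z) (0<+ 0<1 0≤z)
    -- The factor is `c / (z + 1)`; the added 1 keeps the divisor positive when `z` is 0.
    ε : ℝ
    ε = proj₁ (division 0<z+1 c)
    [z+1]ε≈c : (z + 1#) * ε ≈ c
    [z+1]ε≈c = proj₂ (division 0<z+1 c)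
    0<ε : 0# < ε
    0<ε = quotient-pos 0<z+1 [z+1]ε≈c 0<c

  average-≤ : ∀ {u t p q r} → 0# < u → 0# < t → u + t ≈ 1# → p ≤ r → q ≤ r → u * p + t * q ≤ r
  average-≤ {u} {t} {p} {q} {r} 0<u 0<t u+t≈1 p≤r q≤r = begin
    u * p + t * q  ≤⟨ +-mono-≤ (*-monoˡ-≤ (<⇒≤ 0<u) p≤r) (*-monoˡ-≤ (<⇒≤ 0<t) q≤r) ⟩
    u * r + t * r  ≈⟨ distribʳ r u t ⟨
    (u + t) * r    ≈⟨ *-congʳ u+t≈1 ⟩
    1# * r         ≈⟨ *-identityˡ r ⟩
    r              ∎

  average-< : ∀ {u t p q r} → 0# < u → 0# < t → u + t ≈ 1# → p < r → q ≤ r → u * p + t * q < r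
  average-< {u} {t} {p} {q} {r} 0<u 0<t u+t≈1 p<r q≤r = begin-strict
    u * p + t * q  <⟨ +-mono-<-≤ (*-monoˡ-< 0<u p<r) (*-monoˡ-≤ (<⇒≤ 0<t) q≤r) ⟩
    u * r + t * r  ≈⟨ distribʳ r u t ⟨
    (u + t) * r    ≈⟨ *-congʳ u+t≈1 ⟩
    1# * r         ≈⟨ *-identityˡ r ⟩
    r              ∎

  -- Moving from `p` towards `q` by the fraction `t` raises the value by at most `t * z`, where `z`
  -- bounds both 0 and `q - p`. It is enough that this stays below the slack `c = r - p`. Asking for
  -- `(c + z) * t < c` instead of `z * t < c` also gives `t < 1`, so the weight `u = 1 - t` is
  -- positive.
  smallStep : ∀ {p r} q → p < r → ∃[ u ] ∃[ t ] 0# < u × 0# < t × u + t ≈ 1# × u * p + t * q < r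
  smallStep {p} {r} q p<r =
    1# - t , t , x<y⇒0<y-x t<1 , 0<t , solve 2 (λ o t → (o :- t) :+ t := o) refl 1# t , (begin-strict
      (1# - t) * p + t * q           ≈⟨ solve 4 (λ o p q t → (o :- t) :* p :+ t :* q := o :* p :+ t :* (q :- p)) refl 1# p q t ⟩
      1# * p + t * (q - p)           ≈⟨ +-congʳ (*-identityˡ p) ⟩
      p + t * (q - p)                ≤⟨ +-monoʳ-≤ p (*-monoˡ-≤ (<⇒≤ 0<t) q-p≤z) ⟩
      p + t * z                      ≈⟨ +-congˡ (+-identityˡ _) ⟨
      p + (0# + t * z)               ≤⟨ +-monoʳ-≤ p (+-monoˡ-≤ _ (0≤* (<⇒≤ 0<t) (<⇒≤ 0<c))) ⟩
      p + (t * c + t * z)            ≈⟨ solve 4 (λ p c t z → p :+ (t :* c :+ t :* z) := p :+ (c :+ z) :* t) refl p c t z ⟩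
      p + (c + z) * t                <⟨ +-monoʳ-< p [c+z]t<c ⟩
      p + c                          ≈⟨ solve 2 (λ p r → p :+ (r :- p) := r) refl p r ⟩
      r                              ∎)
    where
    c z : ℝ
    c = r - p
    z = proj₁ (upperBound₂ 0# (q - p))
    0<c : 0# < c
    0<c = x<y⇒0<y-x p<r
    0≤z : 0# ≤ z
    0≤z = proj₁ (proj₂ (upperBound₂ 0# (q - p)))
    q-p≤z : q - p ≤ z
    q-p≤z = proj₂ (proj₂ (upperBound₂ 0# (q - p)))
    step : ∃[ t ] 0# < t × (c + z) * t < c
    step = scaleBelow (<⇒≤ (0<+ 0<c 0≤z)) 0<c
    t : ℝ
    t = proj₁ step
    0<t : 0# < t
    0<t = proj₁ (proj₂ step)
    [c+z]t<c : (c + z) * t < c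
    [c+z]t<c = proj₂ (proj₂ step)
    t<1 : t < 1#
    t<1 = *-cancelˡ-< 0<c (begin-strict
      c * t          ≈⟨ +-identityʳ _ ⟨
      c * t + 0#     ≤⟨ +-monoʳ-≤ _ (0≤* 0≤z (<⇒≤ 0<t)) ⟩
      c * t + z * t  ≈⟨ distribʳ t c z ⟨
      (c + z) * t    <⟨ [c+z]t<c ⟩
      c              ≈⟨ *-identityʳ _ ⟨
      c * 1#         ∎)

  -- Spacing of the integers in the reals and the Archimedean property.

  0<fromℕ : ∀ n → 0# < fromℕ (suc n)
  0≤fromℕ : ∀ n → 0# ≤ fromℕ n
  0<fromℕ n = 0<+ 0<1 (0≤fromℕ n)
  0≤fromℕ zero    = ≤-refl
  0≤fromℕ (suc n) = <⇒≤ (0<fromℕ n)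

  fromℤ-suc : ∀ i → fromℤ (ℤ.suc i) ≈ fromℤ i + 1#
  fromℤ-suc i = trans (fromℤ-+ 1ℤ i) (trans (+-congʳ (+-identityʳ 1#)) (+-comm _ _))

  fromℤ-mono-≤ : ∀ {i j} → i ℤ.≤ j → fromℤ i ≤ fromℤ j
  fromℤ-mono-≤ {i} {j} i≤j = begin
    fromℤ i                            ≈⟨ +-identityʳ _ ⟨
    fromℤ i + 0#                       ≤⟨ +-monoʳ-≤ _ (0≤fromℕ ℤ.∣ j ℤ.- i ∣) ⟩
    fromℤ i + fromℤ (+ ℤ.∣ j ℤ.- i ∣)  ≡⟨ ≡.cong (λ k → fromℤ i + fromℤ k) (ℤ.0≤i⇒+∣i∣≡i (ℤ.i≤j⇒0≤j-i i≤j)) ⟩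
    fromℤ i + fromℤ (j ℤ.- i)          ≈⟨ +-congˡ (trans (fromℤ-+ j (ℤ.- i)) (+-congˡ (fromℤ-neg i))) ⟩
    fromℤ i + (fromℤ j - fromℤ i)      ≈⟨ solve 2 (λ i j → i :+ (j :- i) := j) refl (fromℤ i) (fromℤ j) ⟩
    fromℤ j                            ∎

  fromℤ-gap : ∀ {i j} → i ℤ.< j → fromℤ i + 1# ≤ fromℤ j
  fromℤ-gap {i} i<j = ≤-trans (≤-reflexive (sym (fromℤ-suc i))) (fromℤ-mono-≤ (ℤ.i<j⇒suc[i]≤j i<j))

  fromℤ-≉ : ∀ {i j} → i ℤ.< j → ¬ (fromℤ i ≈ fromℤ j)
  fromℤ-≉ {i} {j} i<j i≈j = <⇒≱ (begin-strict
    fromℤ j       ≈⟨ i≈j ⟨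
    fromℤ i       ≈⟨ +-identityʳ _ ⟨
    fromℤ i + 0#  <⟨ +-monoʳ-< _ 0<1 ⟩
    fromℤ i + 1#  ∎) (fromℤ-gap i<j)

  fromℤ-injective : ∀ {i j} → fromℤ i ≈ fromℤ j → i ≡ j
  fromℤ-injective {i} {j} i≈j with ℤ.<-cmp i j
  ... | tri< i<j _ _ = contradiction i≈j (fromℤ-≉ i<j)
  ... | tri≈ _ i≡j _ = i≡j
  ... | tri> _ _ j<i = contradiction (sym i≈j) (fromℤ-≉ j<i)

  -- The shift `w` cancels and distinct integers differ by at least 1. Two lattice points that
  -- differ in some coordinate are thus at least `r` apart there after scaling by `r`.
  scaledGap : ∀ {i j : ℤ} {r} w → 0# ≤ r → i ℤ.< j → r ≤ (r * fromℤ j - w) - (r * fromℤ i - w)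
  scaledGap {i} {j} {r} w 0≤r i<j = begin
    r                                          ≈⟨ solve 2 (λ r p → r := (r :+ p) :- p) refl r (r * fromℤ i) ⟩
    (r + r * fromℤ i) - r * fromℤ i            ≈⟨ +-congʳ (trans (distribˡ r _ _) (trans (+-congˡ (*-identityʳ r)) (+-comm _ _))) ⟨
    r * (fromℤ i + 1#) - r * fromℤ i           ≤⟨ +-monoˡ-≤ _ (*-monoˡ-≤ 0≤r (fromℤ-gap i<j)) ⟩
    r * fromℤ j - r * fromℤ i                  ≈⟨ solve 3 (λ p q w → p :- q := (p :- w) :- (q :- w)) refl (r * fromℤ j) (r * fromℤ i) w ⟩
    (r * fromℤ j - w) - (r * fromℤ i - w)      ∎

  -- If no natural number exceeds `x`, the naturals have a supremum `u`. From `n + 1 ≤ u` for all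
  -- `n` it follows that `u - 1` is an upper bound too, against minimality.
  archimedean : ∀ x → ¬ ¬ (∃[ n ] x < fromℕ n)
  archimedean x unbounded with supremum (λ y → ∃[ n ] y ≈ fromℕ n) (0# , 0 , refl)
    (x , λ { (n , y≈n) → ≤-trans (≤-reflexive y≈n) (≮⇒≥ λ x<n → unbounded (n , x<n)) })
  ... | u , u-upper , u-least = <⇒≱ u-1<u (u-least λ { {y} (n , y≈n) → begin
      y              ≈⟨ y≈n ⟩
      fromℕ n        ≈⟨ solve 2 (λ n o → n := (o :+ n) :- o) refl (fromℕ n) 1# ⟩
      (1# + fromℕ n) - 1#  ≤⟨ +-monoˡ-≤ (- 1#) (u-upper (suc n , refl)) ⟩
      u - 1#         ∎ })
    where
    u-1<u : u - 1# < u
    u-1<u = 0<y-x⇒x<y (<-respʳ-≈ (solve 2 (λ u o → o := u :- (u :- o)) refl u 1#) 0<1)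

  -- The Archimedean property, used twice, gives integers on both sides of `x`. Walking up from the
  -- lower one in unit steps, the first integer beyond `x` exceeds it by at most 1.
  integerAbove : ∀ x → ¬ ¬ (∃[ i ] x < fromℤ i × fromℤ i ≤ x + 1#)
  integerAbove x none =
    archimedean (- x) λ { (m , -x<m) →
    archimedean (x + fromℕ m) λ { (n , x+m<n) →
    none (search n (ℤ.- (+ m))
      (begin
        fromℤ (ℤ.- (+ m))  ≈⟨ fromℤ-neg (+ m) ⟩
        - fromℕ m          ≤⟨ <⇒≤ (neg-mono-< -x<m) ⟩
        - - x              ≈⟨ -‿involutive x ⟩
        x                  ∎)
      (begin-strict
        x                            ≈⟨ solve 2 (λ x m → x := :- m :+ (x :+ m)) refl x (fromℕ m) ⟩
        - fromℕ m + (x + fromℕ m)    <⟨ +-monoʳ-< _ x+m<n ⟩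
        - fromℕ m + fromℕ n          ≈⟨ +-congʳ (fromℤ-neg (+ m)) ⟨
        fromℤ (ℤ.- (+ m)) + fromℕ n  ∎)) } }
    where
    -- The number `n` bounds the remaining steps: `i ≤ x < i + n` is kept throughout, so the walk
    -- cannot reach `n = 0`.
    search : ∀ n i → fromℤ i ≤ x → x < fromℤ i + fromℕ n → ∃[ j ] x < fromℤ j × fromℤ j ≤ x + 1#
    search zero i i≤x x<i = contradiction i≤x (<⇒≱ (<-respʳ-≈ (+-identityʳ _) x<i))
    search (suc n) i i≤x x<i+n = step (compare x (fromℤ (ℤ.suc i)))
      where
      step : Tri (x < fromℤ (ℤ.suc i)) (x ≈ fromℤ (ℤ.suc i)) (fromℤ (ℤ.suc i) < x) →
             ∃[ j ] x < fromℤ j × fromℤ j ≤ x + 1#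
      next : fromℤ (ℤ.suc i) ≤ x → ∃[ j ] x < fromℤ j × fromℤ j ≤ x + 1#
      next i+1≤x = search n (ℤ.suc i) i+1≤x (begin-strict
        x                             <⟨ x<i+n ⟩
        fromℤ i + (1# + fromℕ n)      ≈⟨ +-assoc _ _ _ ⟨
        (fromℤ i + 1#) + fromℕ n      ≈⟨ +-congʳ (fromℤ-suc i) ⟨
        fromℤ (ℤ.suc i) + fromℕ n     ∎)
      step (tri< x<i+1 _ _) = ℤ.suc i , x<i+1 , ≤-trans (≤-reflexive (fromℤ-suc i)) (+-monoˡ-≤ 1# i≤x)
      step (tri≈ _ x≈i+1 _) = next (≤-reflexive (sym x≈i+1))
      step (tri> _ _ i+1<x) = next (<⇒≤ i+1<x)

module Reconstruction (𝓡 : CompleteOrderedField) where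

  open Geometry 𝓡 hiding (zero)
  open OrderedField 𝓡
  open Sum semiring using (sum; sum-cong-≋; ∑-distrib-+; ∑-comm; *-distribˡ-sum; *-distribʳ-sum; sum-replicate-zero)

  -- Finite sums and inner products.

  sum-mono-≤ : ∀ {m} {u v : Fin m → ℝ} → (∀ j → u j ≤ v j) → sum u ≤ sum v
  sum-mono-≤ {zero}  u≤v = ≤-refl
  sum-mono-≤ {suc m} u≤v = +-mono-≤ (u≤v zero) (sum-mono-≤ (u≤v ∘ suc))

  sum-mono-< : ∀ {m} {u v : Fin m → ℝ} → (∀ j → u j ≤ v j) → ∀ k → u k < v k → sum u < sum v
  sum-mono-< u≤v zero    uₖ<vₖ = +-mono-<-≤ uₖ<vₖ (sum-mono-≤ (u≤v ∘ suc))
  sum-mono-< u≤v (suc k) uₖ<vₖ = +-mono-≤-< (u≤v zero) (sum-mono-< (u≤v ∘ suc) k uₖ<vₖ)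

  sum-scaled : ∀ {m} (c : Fin m → ℝ) z → sum c ≈ 1# → sum (λ j → c j * z) ≈ z
  sum-scaled c z Σc≈1 = trans (sym (*-distribʳ-sum z c)) (trans (*-congʳ Σc≈1) (*-identityˡ z))

  sum-neg : ∀ {m} (u : Fin m → ℝ) → sum (λ j → - u j) ≈ - sum u
  sum-neg {zero} u = sym -0≈0
  sum-neg {suc m} u = trans (+-congˡ (sum-neg (u ∘ suc)))
    (solve 2 (λ x y → :- x :+ :- y := :- (x :+ y)) refl (u zero) (sum (u ∘ suc)))

  inner-cong : ∀ {d} (g : ℝ^ d) {x y : ℝ^ d} → x ≋ y → ⟨ g , x ⟩ ≈ ⟨ g , y ⟩
  inner-cong g x≋y = sum-cong-≋ λ k → *-congˡ (x≋y k)

  inner-neg : ∀ {d} (g x : ℝ^ d) → ⟨ -_ ∘ g , x ⟩ ≈ - ⟨ g , x ⟩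
  inner-neg g x = trans (sum-cong-≋ λ k → solve 2 (λ g x → :- g :* x := :- (g :* x)) refl (g k) (x k))
                        (sum-neg λ k → g k * x k)

  inner-combination : ∀ {d m} (g : ℝ^ d) (c : Fin m → ℝ) (v : Fin m → ℝ^ d) →
                      ⟨ g , combination c v ⟩ ≈ sum (λ j → c j * ⟨ g , v j ⟩)
  inner-combination g c v = begin-equality
    sum (λ k → g k * sum (λ j → c j * v j k))    ≈⟨ sum-cong-≋ (λ k → *-distribˡ-sum (g k) (λ j → c j * v j k)) ⟩
    sum (λ k → sum (λ j → g k * (c j * v j k)))  ≈⟨ ∑-comm (λ k j → g k * (c j * v j k)) ⟩
    sum (λ j → sum (λ k → g k * (c j * v j k)))  ≈⟨ sum-cong-≋ (λ j → trans
      (sum-cong-≋ λ k → solve 3 (λ g c v → g :* (c :* v) := c :* (g :* v)) refl (g k) (c j) (v j k))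
      (sym (*-distribˡ-sum (c j) (λ k → g k * v j k)))) ⟩
    sum (λ j → c j * ⟨ g , v j ⟩)                ∎

  segment : ∀ {d} → ℝ → ℝ → ℝ^ d → ℝ^ d → ℝ^ d
  segment u t x y = (u ·ᵥ x) +ᵥ (t ·ᵥ y)

  inner-segment : ∀ {d} (g : ℝ^ d) u t x y → ⟨ g , segment u t x y ⟩ ≈ u * ⟨ g , x ⟩ + t * ⟨ g , y ⟩
  inner-segment g u t x y = begin-equality
    sum (λ k → g k * (u * x k + t * y k))
      ≈⟨ sum-cong-≋ (λ k → solve 5 (λ g u t x y → g :* (u :* x :+ t :* y) := u :* (g :* x) :+ t :* (g :* y))
           refl (g k) u t (x k) (y k)) ⟩
    sum (λ k → u * (g k * x k) + t * (g k * y k))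
      ≈⟨ ∑-distrib-+ (λ k → u * (g k * x k)) (λ k → t * (g k * y k)) ⟩
    sum (λ k → u * (g k * x k)) + sum (λ k → t * (g k * y k))
      ≈⟨ sym (+-cong (*-distribˡ-sum u (λ k → g k * x k)) (*-distribˡ-sum t (λ k → g k * y k))) ⟩
    u * ⟨ g , x ⟩ + t * ⟨ g , y ⟩  ∎

  -- Boxes inside open half-spaces.

  _InBox[_,_] : ∀ {d} → ℝ^ d → ℝ^ d → ℝ → Set
  x InBox[ y , ε ] = ∀ k → y k - ε ≤ x k × x k ≤ y k + ε

  InBox-mono : ∀ {d} {x y : ℝ^ d} {δ ε} → δ ≤ ε → x InBox[ y , δ ] → x InBox[ y , ε ]
  InBox-mono {y = y} δ≤ε x∈box k with x∈box k
  ... | y-δ≤x , x≤y+δ = ≤-trans (+-monoʳ-≤ (y k) (neg-mono-≤ δ≤ε)) y-δ≤x , ≤-trans x≤y+δ (+-monoʳ-≤ (y k) δ≤ε)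

  -- The products `(z - g) * (x - (y - ε))` and `(z + g) * ((y + ε) - x)` have nonnegative factors,
  -- and their sum is twice the right side minus the left side. This avoids a case distinction on
  -- the sign of `g`.
  coordinate-bound : ∀ {g z x y ε} → - g ≤ z → g ≤ z → y - ε ≤ x → x ≤ y + ε → g * x ≤ g * y + z * ε
  coordinate-bound {g} {z} {x} {y} {ε} -g≤z g≤z y-ε≤x x≤y+ε = ≮⇒≥ λ gy+zε<gx →
    <⇒≱ (+-mono-<-≤ (neg (gy+zε<gx)) (<⇒≤ (neg gy+zε<gx))) (begin
      0# + 0#  ≤⟨ +-mono-≤ (0≤* (diff g≤z) (diff y-ε≤x)) (0≤* (diff -g≤z) (diff x≤y+ε)) ⟩
      (z - g) * (x - (y - ε)) + (z - - g) * ((y + ε) - x)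
        ≈⟨ solve 5 (λ g z x y ε → (z :- g) :* (x :- (y :- ε)) :+ (z :- :- g) :* ((y :+ ε) :- x)
                    := ((g :* y :+ z :* ε) :- g :* x) :+ ((g :* y :+ z :* ε) :- g :* x)) refl g z x y ε ⟩
      ((g * y + z * ε) - g * x) + ((g * y + z * ε) - g * x)  ∎)
    where
    diff : ∀ {p q} → p ≤ q → 0# ≤ q - p
    diff {p} p≤q = ≤-trans (≤-reflexive (sym (-‿inverseʳ p))) (+-monoˡ-≤ (- p) p≤q)
    neg : ∀ {p q} → p < q → p - q < 0#
    neg {q = q} p<q = <-respʳ-≈ (-‿inverseʳ q) (+-monoˡ-< (- q) p<q)

  -- Since `z` bounds every entry of `g` in absolute value, the functional grows by at most `Σz * ε`
  -- from the centre to any point of the box. So `ε` is chosen to make this less than the slack at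
  -- `y`.
  openHalfSpace : ∀ {d} (g y : ℝ^ d) {β} → ⟨ g , y ⟩ < β →
                  ∃[ ε ] 0# < ε × ∀ {x} → x InBox[ y , ε ] → ⟨ g , x ⟩ < β
  openHalfSpace {d} g y {β} gy<β with upperBound g | upperBound (-_ ∘ g)
  ... | p , 0≤p , g≤p | q , 0≤q , -g≤q = boxSize (scaleBelow 0≤Σ (x<y⇒0<y-x gy<β))
    where
    z : ℝ
    z = p + q
    g≤z : ∀ k → g k ≤ z
    g≤z k = ≤-trans (g≤p k) (≤-trans (≤-reflexive (sym (+-identityʳ p))) (+-monoʳ-≤ p 0≤q))
    -g≤z : ∀ k → - g k ≤ z
    -g≤z k = ≤-trans (-g≤q k) (≤-trans (≤-reflexive (sym (+-identityˡ q))) (+-monoˡ-≤ q 0≤p))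
    0≤z : 0# ≤ z
    0≤z = ≤-trans (≤-reflexive (sym (+-identityˡ 0#))) (+-mono-≤ 0≤p 0≤q)
    Σz : ℝ
    Σz = sum {d} (λ _ → z)
    0≤Σ : 0# ≤ Σz
    0≤Σ = ≤-trans (≤-reflexive (sym (sum-replicate-zero d))) (sum-mono-≤ {d} {λ _ → 0#} λ _ → 0≤z)
    boxSize : ∃[ ε ] 0# < ε × Σz * ε < β - ⟨ g , y ⟩ →
              ∃[ ε ] 0# < ε × ∀ {x} → x InBox[ y , ε ] → ⟨ g , x ⟩ < β
    boxSize (ε , 0<ε , Σzε<) = ε , 0<ε , λ {x} x∈box → begin-strict
      ⟨ g , x ⟩                          ≤⟨ sum-mono-≤ (λ k → coordinate-bound (-g≤z k) (g≤z k) (proj₁ (x∈box k)) (proj₂ (x∈box k))) ⟩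
      sum (λ k → g k * y k + z * ε)      ≈⟨ ∑-distrib-+ (λ k → g k * y k) (λ _ → z * ε) ⟩
      ⟨ g , y ⟩ + sum {d} (λ _ → z * ε)  ≈⟨ +-congˡ (sym (*-distribʳ-sum {d} ε (λ _ → z))) ⟩
      ⟨ g , y ⟩ + Σz * ε                 <⟨ +-monoʳ-< _ Σzε< ⟩
      ⟨ g , y ⟩ + (β - ⟨ g , y ⟩)        ≈⟨ solve 2 (λ p r → p :+ (r :- p) := r) refl ⟨ g , y ⟩ β ⟩
      β                                  ∎

  openPolyhedron : ∀ {d m} (g : Fin m → ℝ^ d) (y : ℝ^ d) {β : Fin m → ℝ} → (∀ j → ⟨ g j , y ⟩ < β j) →
                   ∃[ ε ] 0# < ε × ∀ {x} → x InBox[ y , ε ] → ∀ j → ⟨ g j , x ⟩ < β j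
  openPolyhedron g y gy<β with positiveLowerBound (λ j → proj₁ (openHalfSpace (g j) y (gy<β j)))
                                                  (λ j → proj₁ (proj₂ (openHalfSpace (g j) y (gy<β j))))
  ... | ε , 0<ε , ε≤ = ε , 0<ε , λ x∈box j →
        proj₂ (proj₂ (openHalfSpace (g j) y (gy<β j))) (InBox-mono (ε≤ j) x∈box)

  -- Affine and convex hulls.

  -- A functional with the constant value `β` on the points takes the value `sum c * β` on their
  -- combination, whatever the signs of the coefficients.
  affineHull-hyperplane : ∀ {d} {P : Pred (ℝ^ d) 0ℓ} (g : ℝ^ d) {β} → P ⊆ Hyperplane g β → AffineHull P ⊆ Hyperplane g β
  affineHull-hyperplane g {β} P⊆H {y} (m , v , c , v∈P , Σc≈1 , y≋) = begin-equality
    ⟨ g , y ⟩                        ≈⟨ inner-cong g y≋ ⟩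
    ⟨ g , combination c v ⟩          ≈⟨ inner-combination g c v ⟩
    sum (λ j → c j * ⟨ g , v j ⟩)    ≈⟨ sum-cong-≋ (λ j → *-congˡ (P⊆H (v∈P j))) ⟩
    sum (λ j → c j * β)              ≈⟨ sum-scaled c β Σc≈1 ⟩
    β                                ∎

  convexHull-upper : ∀ {d m} (v : Fin m → ℝ^ d) k {z} → (∀ j → v j k ≤ z) → ∀ {y} → ConvexHull v y → y k ≤ z
  convexHull-upper v k {z} v≤z {y} (c , 0≤c , Σc≈1 , y≋) = begin
    y k                      ≈⟨ y≋ k ⟩
    sum (λ j → c j * v j k)  ≤⟨ sum-mono-≤ (λ j → *-monoˡ-≤ (0≤c j) (v≤z j)) ⟩
    sum (λ j → c j * z)      ≈⟨ sum-scaled c z Σc≈1 ⟩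
    z                        ∎

  convexHull-lower : ∀ {d m} (v : Fin m → ℝ^ d) k {z} → (∀ j → - v j k ≤ z) → ∀ {y} → ConvexHull v y → - y k ≤ z
  convexHull-lower v k {z} -v≤z {y} (c , 0≤c , Σc≈1 , y≋) = begin
    - y k                        ≈⟨ -‿cong (y≋ k) ⟩
    - sum (λ j → c j * v j k)    ≈⟨ sum-neg (λ j → c j * v j k) ⟨
    sum (λ j → - (c j * v j k))  ≈⟨ sum-cong-≋ (λ j → solve 2 (λ c v → :- (c :* v) := c :* (:- v)) refl (c j) (v j k)) ⟩
    sum (λ j → c j * - v j k)    ≤⟨ sum-mono-≤ (λ j → *-monoˡ-≤ (0≤c j) (-v≤z j)) ⟩
    sum (λ j → c j * z)          ≈⟨ sum-scaled c z Σc≈1 ⟩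
    z                            ∎

  -- Convex combinations obey the coordinate bounds of the finitely many generators. The bounds `p`
  -- from above and `q` from below are nonnegative, so `p + q` serves for both signs.
  polytope-bounded : ∀ {d} {P : Pred (ℝ^ d) 0ℓ} → IsPolytope P →
                     ∃[ z ] 0# ≤ z × ∀ {x} → P x → ∀ k → - x k ≤ z × x k ≤ z
  polytope-bounded {d} (m , v , P⊆hull , _)
    with upperBound (λ k → proj₁ (upperBound λ j → v j k)) | upperBound (λ k → proj₁ (upperBound λ j → - v j k))
  ... | p , 0≤p , ≤p | q , 0≤q , ≤q = p + q ,
    ≤-trans (≤-reflexive (sym (+-identityˡ 0#))) (+-mono-≤ 0≤p 0≤q) , λ x∈P k →
      ≤-trans (convexHull-lower v k (λ j → proj₂ (proj₂ (upperBound λ j → - v j k)) j) (P⊆hull x∈P))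
              (≤-trans (≤q k) (≤-trans (≤-reflexive (sym (+-identityˡ q))) (+-monoˡ-≤ q 0≤p))) ,
      ≤-trans (convexHull-upper v k (λ j → proj₂ (proj₂ (upperBound λ j → v j k)) j) (P⊆hull x∈P))
              (≤-trans (≤p k) (≤-trans (≤-reflexive (sym (+-identityʳ p))) (+-monoʳ-≤ p 0≤q)))

  -- Interior points of full-dimensional polyhedra.

  0<inner-self : ∀ {d} (g : ℝ^ d) k → ¬ (g k ≈ 0#) → 0# < ⟨ g , g ⟩
  0<inner-self {d} g k gₖ≉0 = <-respˡ-≈ (sum-replicate-zero d)
    (sum-mono-< {d} {λ _ → 0#} (λ j → 0≤square (g j)) k (0<square gₖ≉0))

  -- Otherwise the polyhedron lies in the i-th hyperplane, and by full-dimensionality so does the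
  -- whole space. Evaluating at the origin and at the normal `g` itself gives `⟨ g , g ⟩ ≈ 0#`,
  -- although a primitive `g` is nonzero.
  strictPoint : ∀ {n d} (a : Fin n → Vec ℤ d) {b} → FullDimensional (polyhedron a b) → ∀ i → Primitive (a i) →
                ¬ ¬ (∃[ q ] polyhedron a b q × ⟨ embed (a i) , q ⟩ < b i)
  strictPoint {d = d} a {b} full i prim none with primitive⇒nonzero (a i) prim
  ... | k , aₖ≢0 = irrefl (trans (sym ⟨g,0⟩≈0) (trans (onHyperplane (λ _ → 0#)) (sym (onHyperplane g))))
                          (0<inner-self g k (aₖ≢0 ∘ fromℤ-injective))
    where
    g : ℝ^ d
    g = embed (a i)
    tight : polyhedron a b ⊆ Hyperplane g (b i)
    tight {q} q∈P with q∈P i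
    ... | inj₁ gq<b = contradiction (q , q∈P , gq<b) none
    ... | inj₂ gq≈b = gq≈b
    onHyperplane : ∀ y → ⟨ g , y ⟩ ≈ b i
    onHyperplane y = affineHull-hyperplane g tight (full y)
    ⟨g,0⟩≈0 : ⟨ g , (λ _ → 0#) ⟩ ≈ 0#
    ⟨g,0⟩≈0 = trans (sum-cong-≋ λ k → zeroʳ (g k)) (sum-replicate-zero d)

  -- The constraints in the list are made strict one at a time, by moving the current point `y`
  -- slightly towards a point `q` that is strict for constraint `i`. The positive weight of `q`
  -- makes constraint `i` strict, the positive weight of `y` preserves the strictness already
  -- reached, and the small step preserves the inequality for `h`.
  interiorPoint : ∀ {n d} (a : Fin n → Vec ℤ d) {b} →
                  (∀ i → ¬ ¬ (∃[ q ] polyhedron a b q × ⟨ embed (a i) , q ⟩ < b i)) →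
                  ∀ (h : ℝ^ d) {γ x} → polyhedron a b x → ⟨ h , x ⟩ < γ → ∀ is →
                  ¬ ¬ (∃[ y ] polyhedron a b y × ⟨ h , y ⟩ < γ × All (λ i → ⟨ embed (a i) , y ⟩ < b i) is)
  interiorPoint a slack h {x = x} x∈P hx<γ [] none = none (x , x∈P , hx<γ , [])
  interiorPoint {d = d} a {b} slack h {γ} x∈P hx<γ (i ∷ is) none =
    interiorPoint a slack h x∈P hx<γ is λ { (y , y∈P , hy<γ , y-strict) →
    slack i λ { (q , q∈P , aq<b) → none (combine y∈P hy<γ y-strict q∈P aq<b (smallStep ⟨ h , q ⟩ hy<γ)) } }
    where
    combine : ∀ {y q} → polyhedron a b y → ⟨ h , y ⟩ < γ → All (λ i → ⟨ embed (a i) , y ⟩ < b i) is →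
              polyhedron a b q → ⟨ embed (a i) , q ⟩ < b i →
              (∃[ u ] ∃[ t ] 0# < u × 0# < t × u + t ≈ 1# × u * ⟨ h , y ⟩ + t * ⟨ h , q ⟩ < γ) →
              ∃[ y ] polyhedron a b y × ⟨ h , y ⟩ < γ × All (λ i → ⟨ embed (a i) , y ⟩ < b i) (i ∷ is)
    combine {y} {q} y∈P hy<γ y-strict q∈P aq<b (u , t , 0<u , 0<t , u+t≈1 , <γ) =
      segment u t y q ,
      (λ j → ≤-trans (≤-reflexive (inner-segment (embed (a j)) u t y q)) (average-≤ 0<u 0<t u+t≈1 (y∈P j) (q∈P j))) ,
      <-respˡ-≈ (sym (inner-segment h u t y q)) <γ ,
      <-respˡ-≈ (sym (inner-segment (embed (a i)) u t y q))
        (<-respˡ-≈ (+-comm _ _) (average-< 0<t 0<u (trans (+-comm t u) u+t≈1) aq<b (y∈P i))) ∷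
      All.map (λ {j} ay<b → <-respˡ-≈ (sym (inner-segment (embed (a j)) u t y q))
        (average-< 0<u 0<t u+t≈1 ay<b (q∈P j))) y-strict

  -- Simultaneous approximation by scaled and shifted lattice points.

  -- A whole open interval of factors `r` is required, not a single one: it leaves room for the
  -- later coordinates and, in the end, for a reciprocal in the dense set.
  Approximation : ∀ {d} → ℝ^ d → ℝ → ℝ → ℝ → Set
  Approximation {d} y ε α β =
    ∃ λ (z : Vec ℤ d) → ∃ λ (w : Vec ℤ d) → ∃[ α′ ] ∃[ β′ ] α ≤ α′ × α′ < β′ × β′ ≤ β ×
    (∀ {r} → α′ < r → r < β′ → (λ k → r * embed z k - embed w k) InBox[ y , ε ])

  approximate : ∀ {d} (y : ℝ^ d) {ε α β} → 0# < ε → α < β → ¬ ¬ Approximation y ε α β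
  approximate {zero} y {α = α} {β} 0<ε α<β none = none ([] , [] , α , β , ≤-refl , α<β , ≤-refl , λ _ _ ())
  approximate {suc d} y {ε} {α} {β} 0<ε α<β none =
    -- As `n` exceeds `ρ = 1 / (β - α)`, the product `n * r` sweeps an interval longer than 1 while
    -- `r` runs from `α` to `β`. Hence it passes through `i + y₀` for an integer `i`.
    archimedean ρ λ { (n , ρ<n) →
    integerAbove (fromℕ n * α - y zero) λ { (i , <i , i≤) →
    step n (<-trans 0<ρ ρ<n) ρ<n i <i i≤ } }
    where
    y₀ ρ : ℝ
    y₀ = y zero
    ρ = proj₁ (division (x<y⇒0<y-x α<β) 1#)
    [β-α]ρ≈1 : (β - α) * ρ ≈ 1#
    [β-α]ρ≈1 = proj₂ (division (x<y⇒0<y-x α<β) 1#)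
    0<ρ : 0# < ρ
    0<ρ = quotient-pos (x<y⇒0<y-x α<β) [β-α]ρ≈1 0<1
    step : ∀ n → 0# < fromℕ n → ρ < fromℕ n → ∀ i → fromℕ n * α - y₀ < fromℤ i → ¬ (fromℤ i ≤ (fromℕ n * α - y₀) + 1#)
    step n 0<n ρ<n i <i i≤ = shrink (lowerBound₂ α₁<β₁ α₁<β)
      where
      -- These are the factors at which `n * r - i` equals `y₀` and `y₀ + ε`; between them the first
      -- coordinate is in the box.
      α₁ β₁ : ℝ
      α₁ = proj₁ (division 0<n (fromℤ i + y₀))
      β₁ = proj₁ (division 0<n ((fromℤ i + y₀) + ε))
      nα₁≈ : fromℕ n * α₁ ≈ fromℤ i + y₀
      nα₁≈ = proj₂ (division 0<n (fromℤ i + y₀))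
      nβ₁≈ : fromℕ n * β₁ ≈ (fromℤ i + y₀) + ε
      nβ₁≈ = proj₂ (division 0<n ((fromℤ i + y₀) + ε))
      α<α₁ : α < α₁
      α<α₁ = *-cancelˡ-< 0<n (begin-strict
        fromℕ n * α              ≈⟨ solve 2 (λ p y → p := (p :- y) :+ y) refl (fromℕ n * α) y₀ ⟩
        (fromℕ n * α - y₀) + y₀  <⟨ +-monoˡ-< y₀ <i ⟩
        fromℤ i + y₀             ≈⟨ nα₁≈ ⟨
        fromℕ n * α₁             ∎)
      α₁<β₁ : α₁ < β₁
      α₁<β₁ = *-cancelˡ-< 0<n (begin-strict
        fromℕ n * α₁        ≈⟨ nα₁≈ ⟩
        fromℤ i + y₀        ≈⟨ +-identityʳ _ ⟨
        (fromℤ i + y₀) + 0# <⟨ +-monoʳ-< _ 0<ε ⟩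
        (fromℤ i + y₀) + ε  ≈⟨ nβ₁≈ ⟨
        fromℕ n * β₁        ∎)
      α₁<β : α₁ < β
      α₁<β = *-cancelˡ-< 0<n (begin-strict
        fromℕ n * α₁                      ≈⟨ nα₁≈ ⟩
        fromℤ i + y₀                      ≤⟨ +-monoˡ-≤ y₀ i≤ ⟩
        ((fromℕ n * α - y₀) + 1#) + y₀
          ≈⟨ solve 3 (λ p y o → ((p :- y) :+ o) :+ y := p :+ o) refl (fromℕ n * α) y₀ 1# ⟩
        fromℕ n * α + 1#                  ≈⟨ +-congˡ [β-α]ρ≈1 ⟨
        fromℕ n * α + (β - α) * ρ         <⟨ +-monoʳ-< _ (*-monoˡ-< (x<y⇒0<y-x α<β) ρ<n) ⟩
        fromℕ n * α + (β - α) * fromℕ n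
          ≈⟨ solve 3 (λ n α β → n :* α :+ (β :- α) :* n := n :* β) refl (fromℕ n) α β ⟩
        fromℕ n * β                       ∎)
      lower : ∀ {r} → α₁ ≤ r → y₀ - ε ≤ r * fromℕ n - fromℤ i
      lower {r} α₁≤r = begin
        y₀ - ε                    ≤⟨ +-monoʳ-≤ y₀ (≤-trans (<⇒≤ (neg-mono-< 0<ε)) (≤-reflexive -0≈0)) ⟩
        y₀ + 0#                   ≈⟨ +-identityʳ y₀ ⟩
        y₀                        ≈⟨ solve 2 (λ y i → y := (i :+ y) :- i) refl y₀ (fromℤ i) ⟩
        (fromℤ i + y₀) - fromℤ i  ≈⟨ +-congʳ nα₁≈ ⟨
        fromℕ n * α₁ - fromℤ i    ≤⟨ +-monoˡ-≤ _ (*-monoˡ-≤ (<⇒≤ 0<n) α₁≤r) ⟩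
        fromℕ n * r - fromℤ i     ≈⟨ +-congʳ (*-comm _ _) ⟩
        r * fromℕ n - fromℤ i     ∎
      upper : ∀ {r} → r ≤ β₁ → r * fromℕ n - fromℤ i ≤ y₀ + ε
      upper {r} r≤β₁ = begin
        r * fromℕ n - fromℤ i           ≈⟨ +-congʳ (*-comm _ _) ⟩
        fromℕ n * r - fromℤ i           ≤⟨ +-monoˡ-≤ _ (*-monoˡ-≤ (<⇒≤ 0<n) r≤β₁) ⟩
        fromℕ n * β₁ - fromℤ i          ≈⟨ +-congʳ nβ₁≈ ⟩
        ((fromℤ i + y₀) + ε) - fromℤ i  ≈⟨ solve 3 (λ i y ε → ((i :+ y) :+ ε) :- i := y :+ ε) refl (fromℤ i) y₀ ε ⟩
        y₀ + ε                          ∎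
      shrink : ¬ (∃[ β₂ ] α₁ < β₂ × β₂ ≤ β₁ × β₂ ≤ β)
      -- The remaining coordinates only shrink the interval from `α₁` to `β₂`, so the first
      -- coordinate stays in the box.
      shrink (β₂ , α₁<β₂ , β₂≤β₁ , β₂≤β) = approximate (y ∘ suc) 0<ε α₁<β₂
        λ { (z , w , α′ , β′ , α₁≤α′ , α′<β′ , β′≤β₂ , near) →
        none (+ n ∷ z , i ∷ w , α′ , β′ , ≤-trans (<⇒≤ α<α₁) α₁≤α′ , α′<β′ , ≤-trans β′≤β₂ β₂≤β ,
          λ { α′<r r<β′ zero →
                lower (≤-trans α₁≤α′ (<⇒≤ α′<r)) , upper (≤-trans (<⇒≤ r<β′) (≤-trans β′≤β₂ β₂≤β₁))
            ; α′<r r<β′ (suc k) → near α′<r r<β′ k }) }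

  -- Dense sets and reciprocals.

  module _ {D : Pred ℝ 0ℓ} (isDense : IsDenseInPositives D) where

    open IsDenseInPositives isDense

    denseBetween : ∀ {p q} → 0# < p → p < q → ∃[ s ] D s × p < s × s < q
    denseBetween {p} {q} 0<p p<q =
      -- With `h` one half, the centre is the midpoint of `p` and `q` and the radius is half their
      -- distance.
      let s , s∈D , <s , s< = dense (*-pos 0<h (0<+ 0<p (<⇒≤ (<-trans 0<p p<q)))) (*-pos 0<h (x<y⇒0<y-x p<q))
      in s , s∈D , <-respˡ-≈ lower <s , <-respʳ-≈ upper s<
      where
      0<2 : 0# < 1# + 1#
      0<2 = 0<+ 0<1 (<⇒≤ 0<1)
      h : ℝ
      h = proj₁ (division 0<2 1#)
      0<h : 0# < h
      0<h = quotient-pos 0<2 (proj₂ (division 0<2 1#)) 0<1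
      h+h≈1 : h + h ≈ 1#
      h+h≈1 = trans (sym (double h)) (proj₂ (division 0<2 1#))
      lower : h * (p + q) - h * (q - p) ≈ p
      lower = trans (solve 3 (λ h p q → h :* (p :+ q) :- h :* (q :- p) := (h :+ h) :* p) refl h p q)
                    (trans (*-congʳ h+h≈1) (*-identityˡ p))
      upper : h * (p + q) + h * (q - p) ≈ q
      upper = trans (solve 3 (λ h p q → h :* (p :+ q) :+ h :* (q :- p) := (h :+ h) :* q) refl h p q)
                    (trans (*-congʳ h+h≈1) (*-identityˡ q))

    reciprocalBetween : ∀ {α β} → 0# < α → α < β → ∃[ s ] ∃[ r ] D s × s * r ≈ 1# × α < r × r < β
    reciprocalBetween {α} {β} 0<α α<β =
      let q , αq≈1 = division 0<α 1#
          p , βp≈1 = division 0<β 1#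
          0<p = quotient-pos 0<β βp≈1 0<1
          s , s∈D , p<s , s<q = denseBetween 0<p (reciprocal-anti-< 0<α α<β αq≈1 βp≈1)
          r , sr≈1 = division (positive s∈D) 1#
      in s , r , s∈D , sr≈1 ,
         reciprocal-anti-< (positive s∈D) s<q sr≈1 (trans (*-comm q α) αq≈1) ,
         reciprocal-anti-< 0<p p<s (trans (*-comm p β) βp≈1) sr≈1
      where
      0<β : 0# < β
      0<β = <-trans 0<α α<β

  -- Lattice points in dilated translates.

  module _ {s r : ℝ} (sr≈1 : s * r ≈ 1#) {d} (w : Vec ℤ d) {P : Pred (ℝ^ d) 0ℓ} where

    cancel-sr : ∀ x → s * (r * x) ≈ x
    cancel-sr x = trans (sym (*-assoc s r x)) (trans (*-congʳ sr≈1) (*-identityˡ x))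

    ∈-dilate-translate⁺ : ∀ z → P (λ k → r * embed z k - embed w k) → dilate s (translate w P) (embed z)
    ∈-dilate-translate⁺ z x∈P =
      (λ k → r * embed z k) ,
      (_ , x∈P , λ k → solve 2 (λ p w → p := (p :- w) :+ w) refl (r * embed z k) (embed w k)) ,
      λ k → sym (cancel-sr (embed z k))

    -- Solving `z = s(x + w)` for `x` gives `r z - w`. The predicate `P` is not assumed to respect
    -- `≈`, so its point `x` is returned together with the coordinatewise equality.
    ∈-dilate-translate⁻ : ∀ z → dilate s (translate w P) (embed z) →
                          ∃[ x ] P x × ∀ k → r * embed z k - embed w k ≈ x k
    ∈-dilate-translate⁻ z (v , (x , x∈P , v≋x+w) , z≋sv) = x , x∈P , λ k → begin-equality
      r * embed z k - embed w k     ≈⟨ +-congʳ (*-congˡ (z≋sv k)) ⟩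
      r * (s * v k) - embed w k     ≈⟨ +-congʳ (solve 3 (λ r s v → r :* (s :* v) := s :* (r :* v)) refl r s (v k)) ⟩
      s * (r * v k) - embed w k     ≈⟨ +-congʳ (cancel-sr (v k)) ⟩
      v k - embed w k               ≈⟨ +-congʳ (v≋x+w k) ⟩
      (x k + embed w k) - embed w k ≈⟨ solve 2 (λ x w → (x :+ w) :- w := x) refl (x k) (embed w k) ⟩
      x k                           ∎

  member-of-equal-length : ∀ {A : Set} {xs ys : List A} {y} → fromℕ (length xs) ≈ fromℕ (length ys) → y ∈ ys → ∃ (_∈ xs)
  member-of-equal-length {xs = x ∷ _} _ _ = x , here ≡.refl
  member-of-equal-length {xs = []} {_ ∷ ys} 0≈∣ys∣ _ = contradiction (0<fromℕ (length ys)) (irrefl 0≈∣ys∣)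

  -- Equal counts enter only through this consequence: if one set has a lattice point, so has the
  -- other. Nothing relates `z′` to `z` yet.
  equalCount-nonempty : ∀ {d} {S T : Pred (ℝ^ d) 0ℓ} {s y} → IsLatticeCount S s y → IsLatticeCount T s y →
                        ∀ z → dilate s T (embed z) → ∃ λ (z′ : Vec ℤ d) → dilate s S (embed z′)
  equalCount-nonempty (_ , _ , zs⇔S , y≈∣zs∣) (_ , _ , zs′⇔T , y≈∣zs′∣) z z∈T =
    let z′ , z′∈zs = member-of-equal-length (trans (sym y≈∣zs∣) y≈∣zs′∣) (Equivalence.from (zs′⇔T z) z∈T)
    in z′ , Equivalence.to (zs⇔S z′) z′∈zs

  -- Comparison of two solutions.

  module _ {n d} (a : Fin n → Vec ℤ d) (a-prim : ∀ i → Primitive (a i)) {D} (isDense : IsDenseInPositives D)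
           {f b b′} (solP : IsSolution a D f b) (solQ : IsSolution a D f b′) (i : Fin n) where

    private
      module solP = IsSolution solP
      module solQ = IsSolution solQ

      -- Row `zero` is the i-th constraint of the first polytope reversed, and the other rows are
      -- the constraints of the second. Taken strictly, they describe the interior points of the
      -- second polytope beyond the i-th hyperplane of the first.
      g : Fin (suc n) → ℝ^ d
      g = (-_ ∘ embed (a i)) Vector.∷ (embed ∘ a)

      β : Fin (suc n) → ℝ
      β = (- b i) Vector.∷ b′

      SeparatedPoint : Pred (ℝ^ d) 0ℓ
      SeparatedPoint y = ∀ j → ⟨ g j , y ⟩ < β j

    -- A point of the i-th face of the second polytope has the value `b′ i`, which exceeds `b i`. It
    -- is pushed into the interior while staying above `b i`.
    separatedPoint : b i < b′ i → ¬ ¬ (∃ SeparatedPoint)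
    separatedPoint bᵢ<b′ᵢ none = go (solQ.facesNonempty i)
      where
      go : ¬ (∃ (solQ.F i))
      go (x , x∈Q , ax≈b′) =
        interiorPoint a (λ j → strictPoint a solQ.fullDimensional j (a-prim j)) (-_ ∘ embed (a i)) x∈Q
          (<-respˡ-≈ (sym (inner-neg (embed (a i)) x)) (neg-mono-< (<-respʳ-≈ (sym ax≈b′) bᵢ<b′ᵢ)))
          (allFin n) λ { (y , _ , -ay<-b , ay<b′) →
            none (y , λ { zero → -ay<-b ; (suc j) → All.lookup ay<b′ (∈-allFin j) }) }

    noSeparatedLatticePoint : ∀ {M N} → (∀ {x} → polyhedron a b x → ∀ k → - x k ≤ M × x k ≤ M) →
      (∀ {x} → polyhedron a b′ x → ∀ k → - x k ≤ N × x k ≤ N) →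
      ∀ {s r} → D s → s * r ≈ 1# → 0# ≤ r → M + N < r →
      ∀ z w → ¬ SeparatedPoint (λ k → r * embed z k - embed w k)
    noSeparatedLatticePoint {M} {N} P≤M Q≤N {s} {r} s∈D sr≈1 0≤r M+N<r z w separated = go
      (equalCount-nonempty (solP.counts w s∈D) (solQ.counts w s∈D) z (∈-dilate-translate⁺ sr≈1 w {polyhedron a b′} z x∈Q))
      where
      x : ℝ^ d
      x k = r * embed z k - embed w k
      x∈Q : polyhedron a b′ x
      x∈Q j = <⇒≤ (separated (suc j))
      go : ¬ (∃ λ (z′ : Vec ℤ d) → dilate s (translate w (polyhedron a b)) (embed z′))
      go (z′ , z′∈) = compare-with (∈-dilate-translate⁻ sr≈1 w {polyhedron a b} z′ z′∈)
        where
        compare-with : ¬ (∃[ x′ ] polyhedron a b x′ × ∀ k → r * embed z′ k - embed w k ≈ x′ k)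
        compare-with (x′ , x′∈P , rz′-w≈x′) = distinct (lookup-injective same)
          where
          -- Differing coordinates would put `x` and `x′` at least `r` apart, whereas the bounds on
          -- the two polytopes allow at most `M + N`.
          same : ∀ k → Vec.lookup z k ≡ Vec.lookup z′ k
          same k with ℤ.<-cmp (Vec.lookup z k) (Vec.lookup z′ k)
          ... | tri≈ _ zₖ≡z′ₖ _ = zₖ≡z′ₖ
          ... | tri< zₖ<z′ₖ _ _ = contradiction (begin
            r                                   ≤⟨ scaledGap (embed w k) 0≤r zₖ<z′ₖ ⟩
            (r * embed z′ k - embed w k) - x k  ≈⟨ +-congʳ (rz′-w≈x′ k) ⟩
            x′ k - x k                          ≤⟨ +-mono-≤ (proj₂ (P≤M x′∈P k)) (proj₁ (Q≤N x∈Q k)) ⟩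
            M + N                               ∎) (<⇒≱ M+N<r)
          ... | tri> _ _ z′ₖ<zₖ = contradiction (begin
            r                                   ≤⟨ scaledGap (embed w k) 0≤r z′ₖ<zₖ ⟩
            x k - (r * embed z′ k - embed w k)  ≈⟨ +-congˡ (-‿cong (rz′-w≈x′ k)) ⟩
            x k - x′ k                          ≤⟨ +-mono-≤ (proj₂ (Q≤N x∈Q k)) (proj₁ (P≤M x′∈P k)) ⟩
            N + M                               ≈⟨ +-comm N M ⟩
            M + N                               ∎) (<⇒≱ M+N<r)
          -- If `z` and `z′` agree, then `x` coincides with the point `x′` of the first polytope and
          -- satisfies the constraint that row `zero` says it violates.
          distinct : z ≢ z′
          distinct ≡.refl = <⇒≱ (separated zero) (begin
            - b i                     ≤⟨ neg-mono-≤ (x′∈P i) ⟩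
            - ⟨ embed (a i) , x′ ⟩    ≈⟨ -‿cong (sym (inner-cong (embed (a i)) rz′-w≈x′)) ⟩
            - ⟨ embed (a i) , x ⟩     ≈⟨ sym (inner-neg (embed (a i)) x) ⟩
            ⟨ -_ ∘ embed (a i) , x ⟩  ∎)

    constraint-≮ : ¬ (b i < b′ i)
    constraint-≮ bᵢ<b′ᵢ = bounds (polytope-bounded solP.isPolytope) (polytope-bounded solQ.isPolytope)
      where
      bounds : (∃[ M ] 0# ≤ M × ∀ {x} → polyhedron a b x → ∀ k → - x k ≤ M × x k ≤ M) →
               ¬ (∃[ N ] 0# ≤ N × ∀ {x} → polyhedron a b′ x → ∀ k → - x k ≤ N × x k ≤ N)
      bounds (M , 0≤M , P≤M) (N , 0≤N , Q≤N) =
        separatedPoint bᵢ<b′ᵢ λ { (y , y-separated) → nearby y (openPolyhedron g y y-separated) }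
        where
        -- Every `r` above `α` is positive and exceeds `M + N`. The upper end `1# + α` of the
        -- initial interval is arbitrary.
        α : ℝ
        α = 1# + (M + N)
        0≤M+N : 0# ≤ M + N
        0≤M+N = ≤-trans (≤-reflexive (sym (+-identityˡ 0#))) (+-mono-≤ 0≤M 0≤N)
        <1+ : ∀ p → p < 1# + p
        <1+ p = <-respˡ-≈ (+-identityˡ p) (+-monoˡ-< p 0<1)
        nearby : ∀ y → ¬ (∃[ ε ] 0# < ε × ∀ {x} → x InBox[ y , ε ] → SeparatedPoint x)
        nearby y (ε , 0<ε , box) = approximate y 0<ε (<1+ α)
          λ { (z , w , α′ , β′ , α≤α′ , α′<β′ , _ , near) →
              latticePoint z w α≤α′ near (reciprocalBetween isDense (0<α′ α≤α′) α′<β′) }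
          where
          0<α′ : ∀ {α′} → α ≤ α′ → 0# < α′
          0<α′ {α′} α≤α′ = begin-strict
            0#  <⟨ 0<+ 0<1 0≤M+N ⟩
            α   ≤⟨ α≤α′ ⟩
            α′  ∎
          latticePoint : ∀ z w {α′ β′} → α ≤ α′ →
            (∀ {r} → α′ < r → r < β′ → (λ k → r * embed z k - embed w k) InBox[ y , ε ]) →
            ¬ (∃[ s ] ∃[ r ] D s × s * r ≈ 1# × α′ < r × r < β′)
          latticePoint z w {α′} α≤α′ near (s , r , s∈D , sr≈1 , α′<r , r<β′) =
            noSeparatedLatticePoint P≤M Q≤N s∈D sr≈1 (<⇒≤ (<-trans (0<α′ α≤α′) α′<r)) M+N<r z w (box (near α′<r r<β′))
            where
            M+N<r : M + N < r
            M+N<r = begin-strict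
              M + N  <⟨ <1+ (M + N) ⟩
              α      ≤⟨ α≤α′ ⟩
              α′     <⟨ α′<r ⟩
              r      ∎

theorem4p3 : (𝓡 : CompleteOrderedField) → let open Geometry 𝓡 in
    (n d : ℕ) (a : Fin n → Vec ℤ d) →
    (∀ {i j} → i ≢ j → a i ≢ a j) →
    (∀ i → Primitive (a i)) →
    (D : Pred ℝ 0ℓ) → IsDenseInPositives D →
    (f : Vec ℤ d → Func setoid setoid) →
    (b b′ : Fin n → ℝ) → IsSolution a D f b → IsSolution a D f b′ →
    ∀ i → b i ≈ b′ i
theorem4p3 𝓡 n d a _ prim D isDense f b b′ sol sol′ i
  with OrderedField.compare 𝓡 (b i) (b′ i)
... | tri< b<b′ _ _ = contradiction b<b′ (Reconstruction.constraint-≮ 𝓡 a prim isDense sol sol′ i)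
... | tri≈ _ b≈b′ _ = b≈b′
-- The same argument with the two solutions interchanged.
... | tri> _ _ b′<b = contradiction b′<b (Reconstruction.constraint-≮ 𝓡 a prim isDense sol′ sol i)
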